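{- The following lower bounds hold: $$r_4(5,6) \ge 67,\quad r_4(6,6)\ge 133,\quad r_4(6,7)\ge 661,\quad r_4(6,13)\ge 50689,\quad r_4(7,7)\ge 3961,\quad r_4(8,8)\ge 194041.$$
   Context: For integers $k,p,q$, the Ramsey number $r_k(p,q)$ is the smallest integer $N$ such that for every coloring of all $k$-element subsets of $\{1,\dots,N\}$ with the colors red and blue, there exist either $p$ elements of $\{1,\dots,N\}$ all of whose $k$-element subsets are red, or $q$ elements of $\{1,\dots,N\}$ all of whose $k$-element subsets are blue. -}

module Defs where

open import Data.Fin.Subset using (Subset; inside; outside; _⊆_; ∣_∣; ⊥)
open import Data.Fin.Subset.Properties
  using (anySubset?; _⊆?_; drop-∷-⊆; out⊆; in⊆in; ⊆-refl; ∣⊥∣≡0)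
open import Data.Nat.Base using (ℕ; zero; suc; _+_; _≤_; z≤n; s≤s)
open import Data.Nat.Properties using (_≟_; ≡-irrelevant; suc-injective; m≤m+n; m≤n+m)
open import Data.Product.Base using (Σ-syntax; ∃-syntax; _×_; _,_; proj₁; proj₂)
open import Data.Sum.Base using (_⊎_; inj₁; inj₂; swap)
open import Data.Vec.Base using ([]; _∷_; here)
open import Function.Base using (_∘_)
open import Relation.Binary.PropositionalEquality
  using (_≡_; refl; sym; trans; cong; subst)
open import Relation.Nullary using (Dec; yes; no; contradiction)
open import Relation.Nullary.Decidable using (map′; _×-dec_; _⊎-dec_; _→-dec_; ¬?; decidable-stable)
open import Relation.Unary using (Decidable)

data Colour : Set where
  red blue : Colour

-- The vertex set {1,…,N} is rendered as Fin N.
Colouring : ℕ → ℕ → Set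
Colouring k N = (S : Subset N) → ∣ S ∣ ≡ k → Colour

Monochromatic : ∀ {k N} → Colouring k N → Colour → Subset N → Set
Monochromatic {k} {N} χ c T = (S : Subset N) (∣S∣≡k : ∣ S ∣ ≡ k) → S ⊆ T → χ S ∣S∣≡k ≡ c

HasMono : ∀ {k N} → Colouring k N → Colour → ℕ → Set
HasMono {N = N} χ c m = Σ[ T ∈ Subset N ] (∣ T ∣ ≡ m × Monochromatic χ c T)

Arrows : ℕ → ℕ → ℕ → ℕ → Set
Arrows k p q N = (χ : Colouring k N) → HasMono χ red p ⊎ HasMono χ blue q

IsRamseyNumber : ℕ → ℕ → ℕ → ℕ → Set
IsRamseyNumber k p q N = Arrows k p q N × (∀ M → Arrows k p q M → N ≤ M)

------------------------------------------------------------------------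
-- Ramsey's theorem for k-uniform hypergraphs

-- embed T identifies Subset ∣ T ∣ with the subsets of T, order-preservingly.
embed : ∀ {n} (T : Subset n) → Subset ∣ T ∣ → Subset n
embed []            S       = []
embed (outside ∷ T) S       = outside ∷ embed T S
embed (inside  ∷ T) (s ∷ S) = s ∷ embed T S

∣embed∣ : ∀ {n} (T : Subset n) S → ∣ embed T S ∣ ≡ ∣ S ∣
∣embed∣ []            []            = refl
∣embed∣ (outside ∷ T) S             = ∣embed∣ T S
∣embed∣ (inside  ∷ T) (inside  ∷ S) = cong suc (∣embed∣ T S)
∣embed∣ (inside  ∷ T) (outside ∷ S) = ∣embed∣ T S

embed⊆ : ∀ {n} (T : Subset n) S → embed T S ⊆ T
embed⊆ []            []            = ⊆-refl {x = []}
embed⊆ (outside ∷ T) S             = out⊆ (embed⊆ T S)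
embed⊆ (inside  ∷ T) (inside  ∷ S) = in⊆in (embed⊆ T S)
embed⊆ (inside  ∷ T) (outside ∷ S) = out⊆ (embed⊆ T S)

embed-onto : ∀ {n} (T : Subset n) (A : Subset ∣ T ∣) (S : Subset n) → S ⊆ embed T A →
             Σ[ S′ ∈ Subset ∣ T ∣ ] (S′ ⊆ A × embed T S′ ≡ S)
embed-onto []            []            []            _ = [] , ⊆-refl {x = []} , refl
embed-onto (outside ∷ T) A             (inside  ∷ S) S⊆ = contradiction (S⊆ here) λ ()
embed-onto (outside ∷ T) A             (outside ∷ S) S⊆
  with S′ , S′⊆A , eq ← embed-onto T A S (drop-∷-⊆ S⊆) = S′ , S′⊆A , cong (outside ∷_) eq
embed-onto (inside  ∷ T) (outside ∷ A) (inside  ∷ S) S⊆ = contradiction (S⊆ here) λ ()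
embed-onto (inside  ∷ T) (inside  ∷ A) (inside  ∷ S) S⊆
  with S′ , S′⊆A , eq ← embed-onto T A S (drop-∷-⊆ S⊆) =
  inside ∷ S′ , in⊆in S′⊆A , cong (inside ∷_) eq
embed-onto (inside  ∷ T) (_       ∷ A) (outside ∷ S) S⊆
  with S′ , S′⊆A , eq ← embed-onto T A S (drop-∷-⊆ S⊆) =
  outside ∷ S′ , out⊆ S′⊆A , cong (outside ∷_) eq

∣subset∣≤ : ∀ {m N} → m ≤ N → Σ[ T ∈ Subset N ] ∣ T ∣ ≡ m
∣subset∣≤ {N = N} z≤n = ⊥ , ∣⊥∣≡0 N
∣subset∣≤ (s≤s m≤N) with T , eq ← ∣subset∣≤ m≤N = inside ∷ T , cong suc eq

∣S∣≡0⇒≡⊥ : ∀ {n} (S : Subset n) → ∣ S ∣ ≡ 0 → S ≡ ⊥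
∣S∣≡0⇒≡⊥ []            _  = refl
∣S∣≡0⇒≡⊥ (outside ∷ S) eq = cong (outside ∷_) (∣S∣≡0⇒≡⊥ S eq)

χ-cong : ∀ {k N} (χ : Colouring k N) {S S′ : Subset N} → S ≡ S′ →
         (e : ∣ S ∣ ≡ k) (e′ : ∣ S′ ∣ ≡ k) → χ S e ≡ χ S′ e′
χ-cong χ {S} refl e e′ = cong (χ S) (≡-irrelevant e e′)

restrict : ∀ {k N} (T : Subset N) → Colouring k N → Colouring k ∣ T ∣
restrict T χ S e = χ (embed T S) (trans (∣embed∣ T S) e)

restrict-mono : ∀ {k N} (T : Subset N) (χ : Colouring k N) {c A} →
                Monochromatic (restrict T χ) c A → Monochromatic χ c (embed T A)
restrict-mono T χ {A = A} mono S e S⊆ with S′ , S′⊆A , refl ← embed-onto T A S S⊆ =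
  trans (χ-cong χ refl e _) (mono S′ (trans (sym (∣embed∣ T S′)) e) S′⊆A)

link : ∀ {k N} → Colouring (suc k) (suc N) → Colouring k N
link χ S e = χ (inside ∷ S) (cong suc e)

delete : ∀ {k N} → Colouring k (suc N) → Colouring k N
delete χ S e = χ (outside ∷ S) e

delete-mono : ∀ {k N} (χ : Colouring (suc k) (suc N)) {c A} →
              Monochromatic (delete χ) c A → Monochromatic χ c (outside ∷ A)
delete-mono χ mono (inside  ∷ S) e S⊆ = contradiction (S⊆ here) λ ()
delete-mono χ mono (outside ∷ S) e S⊆ = mono S e (drop-∷-⊆ S⊆)

cone-mono : ∀ {k N} (χ : Colouring (suc k) (suc N)) {c A} →
            Monochromatic (link χ) c A → Monochromatic (delete χ) c A →
            Monochromatic χ c (inside ∷ A)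
cone-mono χ lk del (inside  ∷ S) e S⊆ =
  trans (χ-cong χ refl e _) (lk S (suc-injective e) (drop-∷-⊆ S⊆))
cone-mono χ lk del (outside ∷ S) e S⊆ = del S e (drop-∷-⊆ S⊆)

-- Inside a set T on which the link of the new vertex is monochromatic in
-- colour c, a c-coloured set of size m extends to one of size suc m.
extend : ∀ {k N} (χ : Colouring (suc k) (suc N)) (T : Subset N) {c c′ m m′} →
         Monochromatic (link χ) c T →
         HasMono (restrict T (delete χ)) c m ⊎ HasMono (restrict T (delete χ)) c′ m′ →
         HasMono χ c (suc m) ⊎ HasMono χ c′ m′
extend χ T lk (inj₁ (A , eq , mono)) = inj₁
  ( inside ∷ embed T A
  , cong suc (trans (∣embed∣ T A) eq)
  , cone-mono χ (λ S e S⊆ → lk S e (embed⊆ T A ∘ S⊆)) (restrict-mono T (delete χ) mono))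
extend χ T lk (inj₂ (A , eq , mono)) = inj₂
  ( outside ∷ embed T A
  , trans (∣embed∣ T A) eq
  , delete-mono χ (restrict-mono T (delete χ) mono))

empty-mono : ∀ {k} (χ : Colouring (suc k) 0) c → HasMono χ c 0
empty-mono χ c = [] , refl , λ { [] () _ }

ramsey : ∀ k p q → ∃[ N ] Arrows k p q N
ramsey zero p q = p + q , arrows
  where
  arrows : Arrows 0 p q (p + q)
  arrows χ with χ ⊥ (∣⊥∣≡0 (p + q)) in eq
  ... | red with T , ∣T∣ ← ∣subset∣≤ (m≤m+n p q) =
    inj₁ (T , ∣T∣ , λ S e _ → trans (χ-cong χ (∣S∣≡0⇒≡⊥ S e) e _) eq)
  ... | blue with T , ∣T∣ ← ∣subset∣≤ (m≤n+m q p) =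
    inj₂ (T , ∣T∣ , λ S e _ → trans (χ-cong χ (∣S∣≡0⇒≡⊥ S e) e _) eq)
ramsey (suc k) zero    q       = 0 , λ χ → inj₁ (empty-mono χ red)
ramsey (suc k) (suc p) zero    = 0 , λ χ → inj₂ (empty-mono χ blue)
ramsey (suc k) (suc p) (suc q)
  with a , arrᵃ ← ramsey (suc k) p (suc q)
     | b , arrᵇ ← ramsey (suc k) (suc p) q
  with N , arrᴺ ← ramsey k a b = suc N , arrows
  where
  arrows : Arrows (suc k) (suc p) (suc q) (suc N)
  arrows χ with arrᴺ (link χ)
  ... | inj₁ (T , refl , lk) = extend χ T lk (arrᵃ (restrict T (delete χ)))
  ... | inj₂ (T , refl , lk) =
    swap (extend χ T lk (swap (arrᵇ (restrict T (delete χ)))))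

------------------------------------------------------------------------
-- Decidability of Arrows, hence existence of a least N

_≟ᶜ_ : (c d : Colour) → Dec (c ≡ d)
red  ≟ᶜ red  = yes refl
red  ≟ᶜ blue = no λ ()
blue ≟ᶜ red  = no λ ()
blue ≟ᶜ blue = yes refl

allSubset? : ∀ {n} {P : Subset n → Set} → Decidable P → Dec (∀ S → P S)
allSubset? P? = map′
  (λ ¬∃¬ S → decidable-stable (P? S) (λ ¬PS → ¬∃¬ (S , ¬PS)))
  (λ all (S , ¬PS) → ¬PS (all S))
  (¬? (anySubset? (¬? ∘ P?)))

size? : ∀ {k n} {S : Subset n} {P : ∣ S ∣ ≡ k → Set} →
        (∀ e → Dec (P e)) → Dec (∀ e → P e)
size? {k} {S = S} {P} P? with ∣ S ∣ ≟ k
... | no ≢ = yes λ e → contradiction e ≢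
... | yes e = map′ (λ Pe e′ → subst P (≡-irrelevant e e′) Pe) (λ f → f e) (P? e)

hasMono? : ∀ {k N} (χ : Colouring k N) c m → Dec (HasMono χ c m)
hasMono? χ c m = anySubset? λ T → (∣ T ∣ ≟ m) ×-dec
  allSubset? λ S → size? {S = S} λ e → (S ⊆? T) →-dec (χ S e ≟ᶜ c)

_≐_ : ∀ {n} → (f g : Subset n → Colour) → Set
f ≐ g = ∀ S → f S ≡ g S

glue : ∀ {n} → (f g : Subset n → Colour) → Subset (suc n) → Colour
glue f g (inside  ∷ S) = f S
glue f g (outside ∷ S) = g S

glue-cong : ∀ {n} {f f′ g g′ : Subset n → Colour} → f ≐ f′ → g ≐ g′ → glue f g ≐ glue f′ g′
glue-cong f≐ g≐ (inside  ∷ S) = f≐ S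
glue-cong f≐ g≐ (outside ∷ S) = g≐ S

glue-η : ∀ {n} (h : Subset (suc n) → Colour) → glue (h ∘ (inside ∷_)) (h ∘ (outside ∷_)) ≐ h
glue-η h (inside  ∷ S) = refl
glue-η h (outside ∷ S) = refl

allColourFun? : ∀ n {P : (Subset n → Colour) → Set} →
                (∀ {f g} → f ≐ g → P f → P g) → Decidable P → Dec (∀ f → P f)
allColourFun? zero {P} resp P? = map′ to (λ all → all _ , all _)
  (P? (λ _ → red) ×-dec P? (λ _ → blue))
  where
  to : P (λ _ → red) × P (λ _ → blue) → ∀ f → P f
  to (pr , pb) f with f [] in eq
  ... | red  = resp (λ { [] → sym eq }) pr
  ... | blue = resp (λ { [] → sym eq }) pb
allColourFun? (suc n) {P} resp P? = map′
  (λ all h → resp (glue-η h) (all (h ∘ (inside ∷_)) (h ∘ (outside ∷_))))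
  (λ all f g → all (glue f g))
  (allColourFun? n
    (λ f≐ all g → resp (glue-cong f≐ (λ _ → refl)) (all g))
    (λ f → allColourFun? n
      (λ g≐ → resp (glue-cong {f = f} (λ _ → refl) g≐))
      (λ g → P? (glue f g))))

hasMono-cong : ∀ {k N} {χ χ′ : Colouring k N} → (∀ S e → χ S e ≡ χ′ S e) →
               ∀ {c m} → HasMono χ c m → HasMono χ′ c m
hasMono-cong χ≗ (T , eq , mono) = T , eq , λ S e S⊆ → trans (sym (χ≗ S e)) (mono S e S⊆)

arrowsAt-cong : ∀ {k N p q} {χ χ′ : Colouring k N} → (∀ S e → χ S e ≡ χ′ S e) →
                HasMono χ red p ⊎ HasMono χ blue q → HasMono χ′ red p ⊎ HasMono χ′ blue q
arrowsAt-cong χ≗ (inj₁ h) = inj₁ (hasMono-cong χ≗ h)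
arrowsAt-cong χ≗ (inj₂ h) = inj₂ (hasMono-cong χ≗ h)

total : ∀ {k N} → Colouring k N → Subset N → Colour
total {k} χ S with ∣ S ∣ ≟ k
... | yes e = χ S e
... | no  _ = red

total-spec : ∀ {k N} (χ : Colouring k N) S e → total χ S ≡ χ S e
total-spec {k} χ S e with ∣ S ∣ ≟ k
... | yes e′ = cong (χ S) (≡-irrelevant e′ e)
... | no ≢   = contradiction e ≢

arrows? : ∀ k p q → Decidable (Arrows k p q)
arrows? k p q N = map′
  (λ all χ → arrowsAt-cong (total-spec χ) (all (total χ)))
  (λ arr f → arr (λ S _ → f S))
  (allColourFun? N {λ f → HasMono {k} (λ S _ → f S) red p ⊎ HasMono {k} (λ S _ → f S) blue q}
    (λ f≐g → arrowsAt-cong (λ S _ → f≐g S))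
    (λ f → hasMono? _ red p ⊎-dec hasMono? _ blue q))

least : {P : ℕ → Set} → Decidable P → ∀ N → P N → ∃[ n ] (P n × (∀ m → P m → n ≤ m))
least P? zero    PN = 0 , PN , λ _ _ → z≤n
least {P} P? (suc N) PN with P? 0
... | yes P0 = 0 , P0 , λ _ _ → z≤n
... | no ¬P0 with n , Pn , min ← least (P? ∘ suc) N PN = suc n , Pn , minimal
  where
  minimal : ∀ m → P m → suc n ≤ m
  minimal zero    P0 = contradiction P0 ¬P0
  minimal (suc m) Pm = s≤s (min m Pm)

ramseyNumber-exists : ∀ k p q → ∃[ N ] IsRamseyNumber k p q N
ramseyNumber-exists k p q with N , arr ← ramsey k p q = least (arrows? k p q) N arr

-- Abstract so that the type checker never tries to evaluate r k p q, which
-- would search through all colourings; r-isRamseyNumber characterises it.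
abstract
  r : ℕ → ℕ → ℕ → ℕ
  r k p q = proj₁ (ramseyNumber-exists k p q)

  r-isRamseyNumber : ∀ k p q → IsRamseyNumber k p q (r k p q)
  r-isRamseyNumber k p q = proj₂ (ramseyNumber-exists k p q)

{-# OPTIONS --safe #-}
module Submission where

-- Every bound comes from one explicit colouring on 33 points by a product
-- construction.
--
-- Seed.  The projective line over the field of 47 elements carries a colouring
-- of its 4-sets, depending only on the cross-ratio of the four points (more
-- precisely on its j-invariant, so that the order of the points is
-- irrelevant), with no monochromatic 5-set.  Restricted to 0, ..., 32 it is
-- `seed`.  Being invariant under translation, it depends only on the three
-- gaps between consecutive points of a 4-set, so it is enough to inspect the
-- 5-sets that contain 0; this finite check is `seed-check`.
--
-- Product.  Let A be a colouring of the 4-sets of N points and D one of the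
-- 4-sets of d points.  Split d * N points into d consecutive blocks of size N
-- and colour a 4-set as A does if it lies in one block, as D does if it meets
-- four blocks, red if it is split 3 + 1 between two blocks, and blue in the
-- remaining cases 2 + 2 and 2 + 1 + 1.  Two points of a red clique in one
-- block force all the others, but at most one, into that block; hence a red
-- clique is a clique of A with at most one extra point, or a clique of D.
-- Three points of a blue clique in one block force the whole clique into that
-- block; hence a blue clique is a clique of A or at most twice as large as a
-- clique of D.  This is `product-avoids`: if A avoids (p , q), D avoids
-- (suc p , suc s) and 2 * s < q, then the product avoids (suc p , q).
--
-- Starting from (5 , 5) on 33 points, and exchanging the colours where
-- necessary, products with a monochromatic D on 2, 5, 6 or 7 points give all
-- the bounds but the one for (6 , 13).  For that one D is the colouring that
-- avoids (6 , 7) on 660 points and A the one that avoids (5 , 7) on 132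
-- points; their product has 87120 points.

open import Defs
open import Data.Bool.Base using (Bool; true; false)
open import Data.Empty using (⊥; ⊥-elim)
open import Data.Fin.Subset using (Subset; inside; outside; _⊆_; ∣_∣)
open import Data.Fin.Subset.Properties using (out⊆; in⊆in; ⊆-refl)
open import Data.List.Base using (List; []; _∷_; length; map; filter)
open import Data.List.Membership.Propositional using (_∈_; find)
open import Data.List.Membership.Propositional.Properties using (∈-map⁻; ∈-filter⁻)
open import Data.List.Properties using (length-map)
open import Data.List.Relation.Unary.All as All using (All; []; _∷_)
import Data.List.Relation.Unary.All.Properties as All
open import Data.List.Relation.Unary.AllPairs as AllPairs using (AllPairs; []; _∷_)
import Data.List.Relation.Unary.AllPairs.Properties as AllPairs
open import Data.List.Relation.Unary.Any using (here; there; any?)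
open import Data.Nat.Base
  using (ℕ; suc; _+_; _*_; _∸_; _^_; _/_; _%_; _≤_; _<_; _≥_; z≤n; s≤s; s≤s⁻¹; NonZero)
open import Data.Nat.DivMod using (m≡m%n+[m/n]*n; m%n<n; /-monoˡ-≤; m<n*o⇒m/o<n)
open import Data.Nat.Properties
open import Data.Nat.Solver using (module +-*-Solver)
open import Data.Product.Base using (∃-syntax; Σ-syntax; _×_; _,_; proj₁; proj₂)
open import Data.Sum.Base using (_⊎_; inj₁; inj₂)
open import Data.Vec.Base using ([]; _∷_)
open import Function.Base using (_∘_; _on_; id)
open import Relation.Binary.Definitions using (tri<; tri≈; tri>)
open import Relation.Binary.PropositionalEquality
open import Relation.Nullary using (Dec; yes; no; does; ¬_; contradiction)
open import Relation.Nullary.Decidable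
  using (¬?; _×-dec_; _⊎-dec_; dec-true; dec-false; from-yes)
open import Relation.Unary using (Pred; Decidable)

open +-*-Solver using (solve; _:=_; _:+_; con)

-- Colourings of increasing quadruples and their cliques

-- A colouring of the 4-sets of natural numbers: the colour of
-- {a < b < c < d} is f a b c d, and the values at other arguments are
-- irrelevant.
QuadColouring : Set
QuadColouring = ℕ → ℕ → ℕ → ℕ → Colour

-- Finite sets of natural numbers are strictly increasing lists.
Increasing : List ℕ → Set
Increasing = AllPairs _<_

-- All 4-subsets of xs have colour κ.
Clique : QuadColouring → Colour → List ℕ → Set
Clique f κ xs = ∀ {a b c d} → a ∈ xs → b ∈ xs → c ∈ xs → d ∈ xs →
                a < b → b < c → c < d → f a b c d ≡ κ

-- All cliques of colour κ within {0, ..., N - 1} have fewer than m points.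
CliquesBelow : QuadColouring → ℕ → Colour → ℕ → Set
CliquesBelow f N κ m =
  ∀ {xs} → Increasing xs → All (_< N) xs → Clique f κ xs → length xs < m

-- Within {0, ..., N - 1} there is no red clique of p points and no blue clique
-- of q points.
Avoids : QuadColouring → ℕ → ℕ → ℕ → Set
Avoids f N p q = CliquesBelow f N red p × CliquesBelow f N blue q

weaken-blue : ∀ {f N p q q′} → q ≤ q′ → Avoids f N p q → Avoids f N p q′
weaken-blue q≤q′ (avR , avB) = avR , λ inc bd cl → <-≤-trans (avB inc bd cl) q≤q′

opposite : Colour → Colour
opposite red  = blue
opposite blue = red

opposite-involutive : ∀ κ → opposite (opposite κ) ≡ κ
opposite-involutive red  = refl
opposite-involutive blue = refl

exchange : QuadColouring → QuadColouring
exchange f a b c d = opposite (f a b c d)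

exchange-below : ∀ {f N m} κ → CliquesBelow f N κ m → CliquesBelow (exchange f) N (opposite κ) m
exchange-below κ av inc bd cl = av inc bd λ a b c d a<b b<c c<d →
  trans (sym (opposite-involutive _))
    (trans (cong opposite (cl a b c d a<b b<c c<d)) (opposite-involutive κ))

exchange-avoids : ∀ {f N p q} → Avoids f N p q → Avoids (exchange f) N q p
exchange-avoids (avR , avB) = exchange-below blue avB , exchange-below red avR

-- An increasing list in {l, ..., d - 1} has length at most d - l.
increasing-length : ∀ {l d xs} → l ≤ d → Increasing xs → All (l ≤_) xs → All (_< d) xs →
                    l + length xs ≤ d
increasing-length {l} l≤d [] _ _ rewrite +-identityʳ l = l≤d
increasing-length {l} {xs = x ∷ xs} l≤d (x<xs ∷ inc) (l≤x ∷ _) (x<d ∷ bd) = begin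
  l + suc (length xs)  ≡⟨ +-suc l (length xs) ⟩
  suc l + length xs    ≤⟨ +-monoˡ-≤ (length xs) (s≤s l≤x) ⟩
  suc x + length xs    ≤⟨ increasing-length x<d inc x<xs bd ⟩
  _                    ∎
  where open ≤-Reasoning

allRed : QuadColouring
allRed _ _ _ _ = red

-- With every quadruple red, a blue set contains no quadruple at all.
allRed-avoids : ∀ {d p} → d < p → Avoids allRed d p 4
allRed-avoids {d} {p} d<p = avR , avB
  where
  avR : CliquesBelow allRed d red p
  avR inc bd _ = ≤-<-trans (increasing-length z≤n inc (All.universal (λ _ → z≤n) _) bd) d<p

  avB : CliquesBelow allRed d blue 4
  avB {[]}            _ _ _ = s≤s z≤n
  avB {_ ∷ []}        _ _ _ = s≤s (s≤s z≤n)
  avB {_ ∷ _ ∷ []}    _ _ _ = s≤s (s≤s (s≤s z≤n))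
  avB {_ ∷ _ ∷ _ ∷ []} _ _ _ = ≤-refl
  avB {_ ∷ _ ∷ _ ∷ _ ∷ _}
      ((a<b ∷ _) ∷ (b<c ∷ _) ∷ (c<d ∷ _) ∷ _) _ cl
    with () ← cl (here refl) (there (here refl)) (there (there (here refl)))
                 (there (there (there (here refl)))) a<b b<c c<d

allRed-avoids₂ : ∀ {p} → 2 < p → Avoids allRed 2 p 3
allRed-avoids₂ 2<p = proj₁ (allRed-avoids 2<p) ,
  λ inc bd _ → s≤s (increasing-length z≤n inc (All.universal (λ _ → z≤n) _) bd)

-- From quadruple colourings to Ramsey numbers

-- The elements of a subset, with the positions numbered from k onwards.
elementsFrom : ∀ {n} → ℕ → Subset n → List ℕ
elementsFrom k []            = []
elementsFrom k (inside  ∷ S) = k ∷ elementsFrom (suc k) S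
elementsFrom k (outside ∷ S) = elementsFrom (suc k) S

elementsFrom-length : ∀ {n} k (S : Subset n) → length (elementsFrom k S) ≡ ∣ S ∣
elementsFrom-length k []            = refl
elementsFrom-length k (inside  ∷ S) = cong suc (elementsFrom-length (suc k) S)
elementsFrom-length k (outside ∷ S) = elementsFrom-length (suc k) S

elementsFrom-≥ : ∀ {n} k (S : Subset n) → All (k ≤_) (elementsFrom k S)
elementsFrom-≥ k []            = []
elementsFrom-≥ k (inside  ∷ S) = ≤-refl ∷ All.map <⇒≤ (elementsFrom-≥ (suc k) S)
elementsFrom-≥ k (outside ∷ S) = All.map <⇒≤ (elementsFrom-≥ (suc k) S)

elementsFrom-< : ∀ {n} k (S : Subset n) → All (_< k + n) (elementsFrom k S)
elementsFrom-< k [] = []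
elementsFrom-< {suc n} k (s ∷ S) with ih ← elementsFrom-< (suc k) S rewrite +-suc k n with s
... | inside  = s≤s (m≤m+n k n) ∷ ih
... | outside = ih

elementsFrom-increasing : ∀ {n} k (S : Subset n) → Increasing (elementsFrom k S)
elementsFrom-increasing k []            = []
elementsFrom-increasing k (inside  ∷ S) = elementsFrom-≥ (suc k) S ∷ elementsFrom-increasing (suc k) S
elementsFrom-increasing k (outside ∷ S) = elementsFrom-increasing (suc k) S

∈-tail : ∀ {k ys zs} → All (k <_) ys → All (_∈ k ∷ zs) ys → All (_∈ zs) ys
∈-tail []           []                  = []
∈-tail (k<y ∷ _)    (here refl ∷ _)     = contradiction k<y (<-irrefl refl)
∈-tail (_   ∷ k<ys) (there y∈zs ∷ ys∈)  = y∈zs ∷ ∈-tail k<ys ys∈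

subsetOfElements : ∀ {n} k (T : Subset n) {ys} → Increasing ys → All (_∈ elementsFrom k T) ys →
                   Σ[ S ∈ Subset n ] (S ⊆ T × elementsFrom k S ≡ ys)
subsetOfElements k []            []  []       = [] , ⊆-refl {x = []} , refl
subsetOfElements k (outside ∷ T) inc ys∈
  with S , S⊆T , eq ← subsetOfElements (suc k) T inc ys∈ = outside ∷ S , out⊆ S⊆T , eq
subsetOfElements k (inside  ∷ T) []  []
  with S , S⊆T , eq ← subsetOfElements (suc k) T [] [] = outside ∷ S , out⊆ S⊆T , eq
subsetOfElements k (inside  ∷ T) (y<ys ∷ inc) (here refl ∷ ys∈)
  with S , S⊆T , eq ← subsetOfElements (suc k) T inc (∈-tail y<ys ys∈) =
  inside ∷ S , in⊆in S⊆T , cong (k ∷_) eq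
subsetOfElements k (inside  ∷ T) (y<ys ∷ inc) (there y∈ ∷ ys∈)
  with k<y ← All.lookup (elementsFrom-≥ (suc k) T) y∈
  with S , S⊆T , eq ← subsetOfElements (suc k) T (y<ys ∷ inc)
                        (y∈ ∷ ∈-tail (All.map (<-trans k<y) y<ys) ys∈) =
  outside ∷ S , out⊆ S⊆T , eq

-- The value off quadruples is a default that is never used.
applyToList : QuadColouring → List ℕ → Colour
applyToList f (a ∷ b ∷ c ∷ d ∷ []) = f a b c d
applyToList f _                    = red

-- The colouring of the 4-sets of Fin M, its vertices read as 0, ..., M - 1.
toColouring : ∀ {M} → QuadColouring → Colouring 4 M
toColouring f S _ = applyToList f (elementsFrom 0 S)

toColouring-clique : ∀ {M} (f : QuadColouring) {κ} (T : Subset M) →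
                     Monochromatic (toColouring f) κ T → Clique f κ (elementsFrom 0 T)
toColouring-clique f {κ} T mono {a} {b} {c} {d} a∈ b∈ c∈ d∈ a<b b<c c<d
  with S , S⊆T , eq ← subsetOfElements 0 T
         ((a<b ∷ <-trans a<b b<c ∷ <-trans a<b (<-trans b<c c<d) ∷ [])
           ∷ (b<c ∷ <-trans b<c c<d ∷ []) ∷ (c<d ∷ []) ∷ [] ∷ [])
         (a∈ ∷ b∈ ∷ c∈ ∷ d∈ ∷ []) =
  trans (cong (applyToList f) (sym eq))
        (mono S (trans (sym (elementsFrom-length 0 S)) (cong length eq)) S⊆T)

no-mono : ∀ {f N M κ m} → CliquesBelow f N κ m → M ≤ N → ¬ HasMono {N = M} (toColouring f) κ m
no-mono {f} av M≤N (T , ∣T∣≡m , mono) = <⇒≢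
  (av (elementsFrom-increasing 0 T)
      (All.map (λ x<M → <-≤-trans x<M M≤N) (elementsFrom-< 0 T))
      (toColouring-clique f T mono))
  (trans (elementsFrom-length 0 T) ∣T∣≡m)

ramsey-lower-bound : ∀ {f N p q} → Avoids f N p q → r 4 p q ≥ suc N
ramsey-lower-bound {f} {N} {p} {q} (avR , avB) = ≰⇒> λ r≤N →
  neither r≤N (proj₁ (r-isRamseyNumber 4 p q) (toColouring f))
  where
  neither : r 4 p q ≤ N → ¬ (HasMono {N = r 4 p q} (toColouring f) red p ⊎ HasMono (toColouring f) blue q)
  neither r≤N (inj₁ h) = no-mono avR r≤N h
  neither r≤N (inj₂ h) = no-mono avB r≤N h

-- The product of two colourings

length-filter-split : ∀ {p} {P : Pred ℕ p} (P? : Decidable P) xs →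
                      length xs ≡ length (filter P? xs) + length (filter (¬? ∘ P?) xs)
length-filter-split P? []       = refl
length-filter-split P? (x ∷ xs) with does (P? x)
... | true  = cong suc (length-filter-split P? xs)
... | false = trans (cong suc (length-filter-split P? xs))
                    (sym (+-suc (length (filter P? xs)) _))

module Product (A D : QuadColouring) (N : ℕ) .{{_ : NonZero N}} where

  block offset : ℕ → ℕ
  block  a = a / N
  offset a = a % N

  sameBlock? : ∀ a b → Dec (block a ≡ block b)
  sameBlock? a b = block a ≟ block b

  -- The colour of a quadruple a < b < c < d as a function of whether
  -- consecutive points share a block; x and y are the colours given by A and D.
  pattern-colour : Bool → Bool → Bool → Colour → Colour → Colour
  pattern-colour true  true  true  x y = x
  pattern-colour false false false x y = y
  pattern-colour true  true  false x y = red
  pattern-colour false true  true  x y = red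
  pattern-colour _     _     _     x y = blue

  -- The product of A and D: d blocks of N points, block b holding the points
  -- b * N, ..., b * N + N - 1.
  product : QuadColouring
  product a b c d = pattern-colour
    (does (sameBlock? a b)) (does (sameBlock? b c)) (does (sameBlock? c d))
    (A (offset a) (offset b) (offset c) (offset d))
    (D (block a) (block b) (block c) (block d))

  module _ {a b c d : ℕ} where

    product-within : block a ≡ block b → block b ≡ block c → block c ≡ block d →
                     product a b c d ≡ A (offset a) (offset b) (offset c) (offset d)
    product-within ab bc cd
      rewrite dec-true (sameBlock? a b) ab | dec-true (sameBlock? b c) bc
            | dec-true (sameBlock? c d) cd = refl

    product-across : block a ≢ block b → block b ≢ block c → block c ≢ block d →
                     product a b c d ≡ D (block a) (block b) (block c) (block d)
    product-across ab bc cd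
      rewrite dec-false (sameBlock? a b) ab | dec-false (sameBlock? b c) bc
            | dec-false (sameBlock? c d) cd = refl

    product-3+1 : block a ≡ block b → block b ≡ block c → block c ≢ block d →
                  product a b c d ≡ red
    product-3+1 ab bc cd
      rewrite dec-true (sameBlock? a b) ab | dec-true (sameBlock? b c) bc
            | dec-false (sameBlock? c d) cd = refl

    product-1+3 : block a ≢ block b → block b ≡ block c → block c ≡ block d →
                  product a b c d ≡ red
    product-1+3 ab bc cd
      rewrite dec-false (sameBlock? a b) ab | dec-true (sameBlock? b c) bc
            | dec-true (sameBlock? c d) cd = refl

    product-blue-left : block a ≡ block b → block b ≢ block c → product a b c d ≡ blue
    product-blue-left ab bc
      rewrite dec-true (sameBlock? a b) ab | dec-false (sameBlock? b c) bc = refl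

    product-blue-middle : block a ≢ block b → block b ≡ block c → block c ≢ block d →
                          product a b c d ≡ blue
    product-blue-middle ab bc cd
      rewrite dec-false (sameBlock? a b) ab | dec-true (sameBlock? b c) bc
            | dec-false (sameBlock? c d) cd = refl

    product-blue-right : block b ≢ block c → block c ≡ block d → product a b c d ≡ blue
    product-blue-right bc cd
      rewrite dec-false (sameBlock? b c) bc | dec-true (sameBlock? c d) cd
      with does (sameBlock? a b)
    ... | true  = refl
    ... | false = refl

  block-< : ∀ {a b} → a < b → block a ≢ block b → block a < block b
  block-< a<b = ≤∧≢⇒< (/-monoˡ-≤ N (<⇒≤ a<b))

  <-from-block : ∀ {a b} → block a < block b → a < b
  <-from-block lt = ≰⇒> λ b≤a → <⇒≱ lt (/-monoˡ-≤ N b≤a)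

  decompose : ∀ a → a ≡ offset a + block a * N
  decompose a = m≡m%n+[m/n]*n a N

  decompose-at : ∀ {a b} → block a ≡ block b → b ≡ offset b + block a * N
  decompose-at {b = b} eq = trans (decompose b) (cong (λ β → offset b + β * N) (sym eq))

  offset-< : ∀ {a b} → block a ≡ block b → a < b → offset a < offset b
  offset-< {a} {b} eq a<b =
    +-cancelʳ-< (block a * N) _ _ (subst₂ _<_ (decompose a) (decompose-at eq) a<b)

  <-from-offset : ∀ {a b} → block a ≡ block b → offset a < offset b → a < b
  <-from-offset {a} {b} eq lt = subst₂ _<_ (sym (decompose a)) (sym (decompose-at eq))
    (+-monoˡ-< (block a * N) lt)

  outside-block : ∀ {w x y} → x < y → block x ≡ block y → block w ≢ block x → w < x ⊎ y < w
  outside-block {w} {x} {y} x<y xy w≢x with <-cmp w x | <-cmp y w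
  ... | tri< w<x _ _ | _            = inj₁ w<x
  ... | _            | tri< y<w _ _ = inj₂ y<w
  ... | tri≈ _ w≡x _ | _            = contradiction (cong block w≡x) w≢x
  ... | _            | tri≈ _ y≡w _ = contradiction (trans (cong block (sym y≡w)) (sym xy)) w≢x
  ... | tri> _ _ x<w | tri> _ _ w<y = contradiction
    (≤-antisym (subst (block w ≤_) (sym xy) (/-monoˡ-≤ N (<⇒≤ w<y))) (/-monoˡ-≤ N (<⇒≤ x<w))) w≢x

  -- A clique inside one block is, up to translation, a clique of A.
  within-block : ∀ {κ m β zs} → CliquesBelow A N κ m → Increasing zs →
                 All (λ z → block z ≡ β) zs → Clique product κ zs → length zs < m
  within-block {κ} {m} {β} {zs} avA inc inβ cl = subst (_< m) (length-map offset zs)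
    (avA (AllPairs.map⁺ (offsets-increasing inc inβ))
         (All.map⁺ (All.universal (λ z → m%n<n z N) zs)) clA)
    where
    offsets-increasing : ∀ {zs} → Increasing zs → All (λ z → block z ≡ β) zs →
                         AllPairs (_<_ on offset) zs
    offsets-increasing []           []         = []
    offsets-increasing (z<zs ∷ inc) (zβ ∷ zsβ) =
      All.zipWith (λ (z<w , wβ) → offset-< (trans zβ (sym wβ)) z<w) (z<zs , zsβ)
        ∷ offsets-increasing inc zsβ

    same : ∀ {a b} → a ∈ zs → b ∈ zs → block a ≡ block b
    same a∈ b∈ = trans (All.lookup inβ a∈) (sym (All.lookup inβ b∈))

    clA : Clique A κ (map offset zs)
    clA a∈ b∈ c∈ d∈ a<b b<c c<d
      with _ , a∈ , refl ← ∈-map⁻ offset a∈ | _ , b∈ , refl ← ∈-map⁻ offset b∈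
         | _ , c∈ , refl ← ∈-map⁻ offset c∈ | _ , d∈ , refl ← ∈-map⁻ offset d∈ =
      trans (sym (product-within ab bc cd))
            (cl a∈ b∈ c∈ d∈ (<-from-offset ab a<b) (<-from-offset bc b<c) (<-from-offset cd c<d))
      where
      ab = same a∈ b∈
      bc = same b∈ c∈
      cd = same c∈ d∈

  -- A clique with all its points in different blocks is a clique of D.
  across-blocks : ∀ {d κ m zs} → CliquesBelow D d κ m → AllPairs (_<_ on block) zs →
                  All (_< d * N) zs → Clique product κ zs → length zs < m
  across-blocks {d} {κ} {m} {zs} avD inc bd cl = subst (_< m) (length-map block zs)
    (avD (AllPairs.map⁺ inc) (All.map⁺ (All.map m<n*o⇒m/o<n bd)) clD)
    where
    clD : Clique D κ (map block zs)
    clD a∈ b∈ c∈ d∈ a<b b<c c<d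
      with _ , a∈ , refl ← ∈-map⁻ block a∈ | _ , b∈ , refl ← ∈-map⁻ block b∈
         | _ , c∈ , refl ← ∈-map⁻ block c∈ | _ , d∈ , refl ← ∈-map⁻ block d∈ =
      trans (sym (product-across (<⇒≢ a<b) (<⇒≢ b<c) (<⇒≢ c<d)))
            (cl a∈ b∈ c∈ d∈ (<-from-block a<b) (<-from-block b<c) (<-from-block c<d))

  -- Red cliques of a product

  -- Some two points of xs share a block.
  PairInBlock : List ℕ → Set
  PairInBlock xs = ∃[ x ] ∃[ y ] (x ∈ xs × y ∈ xs × x < y × block x ≡ block y)

  pair-or-distinct : ∀ {xs} → Increasing xs → PairInBlock xs ⊎ AllPairs (_<_ on block) xs
  pair-or-distinct [] = inj₂ []
  pair-or-distinct {x ∷ xs} (x<xs ∷ inc) with any? (sameBlock? x) xs | pair-or-distinct inc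
  ... | yes p | _ with y , y∈ , xy ← find p =
    inj₁ (x , y , here refl , there y∈ , All.lookup x<xs y∈ , xy)
  ... | no _  | inj₁ (u , v , u∈ , v∈ , uv) = inj₁ (u , v , there u∈ , there v∈ , uv)
  ... | no ¬p | inj₂ distinct               = inj₂
    (All.zipWith (λ (x<y , ¬xy) → block-< x<y ¬xy) (x<xs , All.¬Any⇒All¬ xs ¬p) ∷ distinct)

  -- Next to two points of one block a red clique has at most one point
  -- outside that block.
  at-most-one-outside : ∀ {xs x y u v} → Clique product red xs →
                        x ∈ xs → y ∈ xs → u ∈ xs → v ∈ xs → x < y → block x ≡ block y →
                        u < v → block u ≢ block x → ¬ (block v ≢ block x)
  at-most-one-outside cl x∈ y∈ u∈ v∈ x<y xy u<v ux vx
    with outside-block x<y xy ux | outside-block x<y xy vx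
  ... | inj₁ u<x | inj₁ v<x with () ← trans (sym (cl u∈ v∈ x∈ y∈ u<v v<x x<y))
                                            (product-blue-right vx xy)
  ... | inj₁ u<x | inj₂ y<v with () ← trans (sym (cl u∈ x∈ y∈ v∈ u<x x<y y<v))
                                            (product-blue-middle ux xy (λ yv → vx (sym (trans xy yv))))
  ... | inj₂ y<u | inj₂ y<v with () ← trans (sym (cl x∈ y∈ u∈ v∈ x<y y<u u<v))
                                            (product-blue-left xy (λ yu → ux (sym (trans xy yu))))
  ... | inj₂ y<u | inj₁ v<x = contradiction (<-trans x<y (<-trans y<u u<v)) (<-asym v<x)

  red-below : ∀ {d p} → CliquesBelow A N red p → CliquesBelow D d red (suc p) →
              CliquesBelow product (d * N) red (suc p)
  red-below {d} {p} avA avD {xs} inc bd cl with pair-or-distinct inc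
  ... | inj₂ distinct = across-blocks avD distinct bd cl
  ... | inj₁ (x , y , x∈ , y∈ , x<y , xy) = begin-strict
    length xs                      ≡⟨ length-filter-split inBlock? xs ⟩
    length ins + length outs       <⟨ +-mono-<-≤ ins-short outs-short ⟩
    p + 1                          ≡⟨ +-comm p 1 ⟩
    suc p                          ∎
    where
    open ≤-Reasoning

    inBlock? : Decidable (λ z → block z ≡ block x)
    inBlock? z = sameBlock? z x

    ins outs : List ℕ
    ins  = filter inBlock? xs
    outs = filter (¬? ∘ inBlock?) xs

    ins-short : length ins < p
    ins-short = within-block avA (AllPairs.filter⁺ inBlock? inc) (All.all-filter inBlock? xs)
      λ a∈ b∈ c∈ d∈ → cl (proj₁ (∈-filter⁻ inBlock? a∈)) (proj₁ (∈-filter⁻ inBlock? b∈))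
                         (proj₁ (∈-filter⁻ inBlock? c∈)) (proj₁ (∈-filter⁻ inBlock? d∈))

    short : ∀ {zs} → Increasing zs → (∀ {z} → z ∈ zs → z ∈ xs × block z ≢ block x) → length zs ≤ 1
    short []       _ = z≤n
    short ([] ∷ _) _ = s≤s z≤n
    short ((u<v ∷ _) ∷ _) sub
      with u∈ , ux ← sub (here refl) | v∈ , vx ← sub (there (here refl)) =
      contradiction vx (at-most-one-outside cl x∈ y∈ u∈ v∈ x<y xy u<v ux)

    outs-short : length outs ≤ 1
    outs-short = short (AllPairs.filter⁺ (¬? ∘ inBlock?) inc) (∈-filter⁻ (¬? ∘ inBlock?))

  -- Blue cliques of a product

  -- Some three points of xs share a block.
  TripleInBlock : List ℕ → Set
  TripleInBlock xs = ∃[ x ] ∃[ y ] ∃[ z ] (x ∈ xs × y ∈ xs × z ∈ xs ×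
    x < y × y < z × block x ≡ block y × block y ≡ block z)

  -- Points of xs in different blocks, at least half as many as xs has.
  Transversal : List ℕ → Set
  Transversal xs = ∃[ ys ] ((∀ {y} → y ∈ ys → y ∈ xs) × AllPairs (_<_ on block) ys ×
    length xs ≤ 2 * length ys)

  weaken-triple : ∀ {x xs} → TripleInBlock xs → TripleInBlock (x ∷ xs)
  weaken-triple (a , b , c , a∈ , b∈ , c∈ , rest) = a , b , c , there a∈ , there b∈ , there c∈ , rest

  -- Adding x to a transversal of the points ws in later blocks doubles up for
  -- one further point of xs besides ws.
  extend-transversal : ∀ {x xs ws} → All (λ w → block x < block w) ws → (∀ {w} → w ∈ ws → w ∈ xs) →
                       length xs ≤ suc (length ws) → Transversal ws → Transversal (x ∷ xs)
  extend-transversal {x} {xs} {ws} x<ws ws⊆xs short (ys , ys⊆ws , distinct , len) =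
    x ∷ ys ,
    (λ { (here eq) → here eq ; (there y∈) → there (ws⊆xs (ys⊆ws y∈)) }) ,
    All.tabulate (λ y∈ → All.lookup x<ws (ys⊆ws y∈)) ∷ distinct ,
    (begin
      suc (length xs)              ≤⟨ s≤s short ⟩
      2 + length ws                ≤⟨ +-monoʳ-≤ 2 len ⟩
      2 + 2 * length ys            ≡⟨ *-suc 2 (length ys) ⟨
      2 * suc (length ys)          ∎)
    where open ≤-Reasoning

  later-blocks : ∀ {x y xs} → block x < block y → All (y <_) xs → All (λ w → block x < block w) xs
  later-blocks xy = All.map λ y<w → <-≤-trans xy (/-monoˡ-≤ N (<⇒≤ y<w))

  -- The points of one block are consecutive in an increasing list.
  triple-or-transversal : ∀ {xs} → Increasing xs → TripleInBlock xs ⊎ Transversal xs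
  triple-or-transversal {[]} _ = inj₂ ([] , id , [] , z≤n)
  triple-or-transversal {x ∷ []} _ = inj₂ (x ∷ [] , id , [] ∷ [] , s≤s z≤n)
  triple-or-transversal {x ∷ y ∷ []} ((x<y ∷ _) ∷ _) with sameBlock? x y
  ... | yes _  = inj₂ (x ∷ [] , (λ { (here eq) → here eq }) , [] ∷ [] , ≤-refl)
  ... | no ¬xy = inj₂ (x ∷ y ∷ [] , id , (block-< x<y ¬xy ∷ []) ∷ [] ∷ [] , s≤s (s≤s z≤n))
  triple-or-transversal {x ∷ y ∷ z ∷ xs} ((x<y ∷ _) ∷ inc₁@((y<z ∷ y<xs) ∷ inc₂@(z<xs ∷ _)))
    with sameBlock? x y | sameBlock? y z | triple-or-transversal inc₁ | triple-or-transversal inc₂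
  ... | yes xy | yes yz | _           | _           =
    inj₁ (x , y , z , here refl , there (here refl) , there (there (here refl)) , x<y , y<z , xy , yz)
  ... | yes _  | no _   | _           | inj₁ triple = inj₁ (weaken-triple (weaken-triple triple))
  ... | yes xy | no ¬yz | _           | inj₂ trv    =
    inj₂ (extend-transversal (x⋖z ∷ later-blocks x⋖z z<xs) there ≤-refl trv)
    where x⋖z = subst (_< block z) (sym xy) (block-< y<z ¬yz)
  ... | no _   | _      | inj₁ triple | _           = inj₁ (weaken-triple triple)
  ... | no ¬xy | _      | inj₂ trv    | _           =
    inj₂ (extend-transversal (x⋖y ∷ later-blocks x⋖y (y<z ∷ y<xs)) id (n≤1+n _) trv)
    where x⋖y = block-< x<y ¬xy

  blue-below : ∀ {d q s} → CliquesBelow A N blue q → CliquesBelow D d blue (suc s) → 2 * s < q →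
               CliquesBelow product (d * N) blue q
  blue-below {d} {q} {s} avA avD 2s<q {xs} inc bd cl with triple-or-transversal inc
  ... | inj₁ (x , y , z , x∈ , y∈ , z∈ , x<y , y<z , xy , yz) =
    within-block avA inc (All.tabulate in-block) cl
    where
    in-block : ∀ {w} → w ∈ xs → block w ≡ block x
    in-block {w} w∈ with sameBlock? w x
    ... | yes wx = wx
    ... | no ¬wx with outside-block (<-trans x<y y<z) (trans xy yz) ¬wx
    ...   | inj₁ w<x with () ← trans (sym (cl w∈ x∈ y∈ z∈ w<x x<y y<z)) (product-1+3 ¬wx xy yz)
    ...   | inj₂ z<w with () ← trans (sym (cl x∈ y∈ z∈ w∈ x<y y<z z<w))
                                     (product-3+1 xy yz (λ zw → ¬wx (sym (trans xy (trans yz zw)))))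
  ... | inj₂ (ys , ys⊆xs , distinct , len) = begin-strict
    length xs      ≤⟨ len ⟩
    2 * length ys  ≤⟨ *-monoʳ-≤ 2 (s≤s⁻¹ ys-short) ⟩
    2 * s          <⟨ 2s<q ⟩
    q              ∎
    where
    open ≤-Reasoning

    ys-short : length ys < suc s
    ys-short = across-blocks avD distinct (All.tabulate (All.lookup bd ∘ ys⊆xs))
      λ a∈ b∈ c∈ d∈ → cl (ys⊆xs a∈) (ys⊆xs b∈) (ys⊆xs c∈) (ys⊆xs d∈)

  product-avoids : ∀ {d p q s} → Avoids A N p q → Avoids D d (suc p) (suc s) → 2 * s < q →
                   Avoids product (d * N) (suc p) q
  product-avoids (redA , blueA) (redD , blueD) 2s<q =
    red-below redA redD , blue-below blueA blueD 2s<q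

open Product using (product; product-avoids)

-- The seed: 33 points without monochromatic 5-sets

-- Abstract, because `gapColour` at variable gaps has a huge normal form.
abstract

  -- The colour of a 4-set a < b < c < d with gaps x, y, z between consecutive
  -- points.  The numbers (b - a)(d - c), (c - b)(d - a) and (c - a)(d - b) are
  -- X, Y and X + Y.  The ratio of M ^ 3 to E is, up to a constant factor, the
  -- j-invariant of the cross-ratio, and M ^ 3 and E are symmetric in the four
  -- points.  Of the eight values of the ratio modulo 47, namely 3, 4, 13, 20,
  -- 37, 42, 43 and 46, four are made red; up to exchanging the colours, this is
  -- the only choice that leaves no monochromatic 5-set on the whole projective
  -- line.
  gapColour : ℕ → ℕ → ℕ → Colour
  gapColour x y z = choose
    (hasRatio? 3 ⊎-dec hasRatio? 13 ⊎-dec hasRatio? 20 ⊎-dec hasRatio? 46)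
    where
    X Y M E : ℕ
    X = x * z
    Y = y * (x + y + z)
    M = X * X + X * Y + Y * Y
    E = (X * Y * (X + Y)) ^ 2

    hasRatio? : ∀ t → Dec ((M ^ 3) % 47 ≡ (t * E) % 47)
    hasRatio? t = (M ^ 3) % 47 ≟ (t * E) % 47

    choose : {P : Set} → Dec P → Colour
    choose (yes _) = red
    choose (no _)  = blue

-- The colouring of the 4-sets of 0, ..., 32, read as residues modulo 47.
seed : QuadColouring
seed a b c d = gapColour (b ∸ a) (c ∸ b) (d ∸ c)

-- All five 4-subsets of a 5-set with gaps x, y, z, w have the same colour.
MonoGaps : ℕ → ℕ → ℕ → ℕ → Set
MonoGaps x y z w =
  gapColour y z w ≡ gapColour x y z ×
  gapColour (x + y) z w ≡ gapColour x y z ×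
  gapColour x (y + z) w ≡ gapColour x y z ×
  gapColour x y (z + w) ≡ gapColour x y z

abstract

  monoGaps? : ∀ x y z w → Dec (MonoGaps x y z w)
  monoGaps? x y z w =
    (gapColour y z w ≟ᶜ gapColour x y z) ×-dec
    (gapColour (x + y) z w ≟ᶜ gapColour x y z) ×-dec
    (gapColour x (y + z) w ≟ᶜ gapColour x y z) ×-dec
    (gapColour x y (z + w) ≟ᶜ gapColour x y z)

  -- The gaps of a 5-set within 0, ..., 32 are positive with sum at most 32; they
  -- are one more than x, y, z, w, whence x + y + z + w < 29.
  seed-check : ∀ {x} → x < 29 → ∀ {y} → y < 29 ∸ x → ∀ {z} → z < 29 ∸ x ∸ y →
               ∀ {w} → w < 29 ∸ x ∸ y ∸ z → ¬ MonoGaps (suc x) (suc y) (suc z) (suc w)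
  seed-check = from-yes (
    allUpTo? (λ x → allUpTo? (λ y → allUpTo? (λ z → allUpTo? (λ w →
      ¬? (monoGaps? (suc x) (suc y) (suc z) (suc w)))
      (29 ∸ x ∸ y ∸ z)) (29 ∸ x ∸ y)) (29 ∸ x)) 29)

seed-gaps : ∀ a b c d {x y z} → b ∸ a ≡ x → c ∸ b ≡ y → d ∸ c ≡ z →
            seed a b c d ≡ gapColour x y z
seed-gaps _ _ _ _ refl refl refl = refl

no-mono-5-set : ∀ {κ} a x y z w → let b = a + suc x; c = b + suc y; d = c + suc z; e = d + suc w in
                e < 33 → seed a b c d ≡ κ → seed b c d e ≡ κ → seed a c d e ≡ κ →
                seed a b d e ≡ κ → seed a b c e ≡ κ → ⊥
no-mono-5-set {κ} a x y z w e<33 abcd bcde acde abde abce =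
  seed-check (≤-<-trans (m≤m+n x _) x+<29) (≤-<-trans (m≤m+n y _) y+<) (≤-<-trans (m≤m+n z w) z+<) w<
    ( agree bcde (seed-gaps b c d e (one b y) (one c z) (one d w))
    , agree acde (seed-gaps a c d e (two a x y) (one c z) (one d w))
    , agree abde (seed-gaps a b d e (one a x) (two b y z) (one d w))
    , agree abce (seed-gaps a b c e (one a x) (one b y) (two c z w)) )
  where
  b = a + suc x
  c = b + suc y
  d = c + suc z
  e = d + suc w

  one : ∀ u k → (u + suc k) ∸ u ≡ suc k
  one u k = m+n∸m≡n u (suc k)

  two : ∀ u k l → (u + suc k + suc l) ∸ u ≡ suc k + suc l
  two u k l = trans (cong (_∸ u) (+-assoc u (suc k) (suc l))) (m+n∸m≡n u (suc k + suc l))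

  agree : ∀ {χ χ′} → χ ≡ κ → χ ≡ χ′ → χ′ ≡ gapColour (suc x) (suc y) (suc z)
  agree χ≡κ χ≡χ′ = trans (sym χ≡χ′) (trans χ≡κ
    (trans (sym abcd) (seed-gaps a b c d (one a x) (one b y) (one c z))))

  move : ∀ m {n o} → m + n < o → n < o ∸ m
  move m {n} {o} lt = m+n≤o⇒m≤o∸n (suc n) (subst (_< o) (+-comm m n) lt)

  sum-of-gaps : a + suc x + suc y + suc z + suc w ≡ a + (4 + (x + (y + (z + w))))
  sum-of-gaps = solve 5 (λ a x y z w →
    a :+ (con 1 :+ x) :+ (con 1 :+ y) :+ (con 1 :+ z) :+ (con 1 :+ w)
      := a :+ (con 4 :+ (x :+ (y :+ (z :+ w))))) refl a x y z w

  x+<29 : x + (y + (z + w)) < 29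
  x+<29 = +-cancelˡ-< 4 _ _ (≤-<-trans (m≤n+m _ a) (subst (_< 33) sum-of-gaps e<33))

  y+< : y + (z + w) < 29 ∸ x
  y+< = move x x+<29

  z+< : z + w < 29 ∸ x ∸ y
  z+< = move y y+<

  w< : w < 29 ∸ x ∸ y ∸ z
  w< = move z z+<

gap : ∀ {a b} → a < b → ∃[ x ] a + suc x ≡ b
gap {a} a<b with x , eq ← m≤n⇒∃[o]m+o≡n a<b = x , trans (+-suc a x) eq

seed-avoids : Avoids seed 33 5 5
seed-avoids = below , below
  where
  below : ∀ {κ} → CliquesBelow seed 33 κ 5
  below {xs = []}                 _ _ _ = s≤s z≤n
  below {xs = _ ∷ []}             _ _ _ = s≤s (s≤s z≤n)
  below {xs = _ ∷ _ ∷ []}         _ _ _ = s≤s (s≤s (s≤s z≤n))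
  below {xs = _ ∷ _ ∷ _ ∷ []}     _ _ _ = s≤s (s≤s (s≤s (s≤s z≤n)))
  below {xs = _ ∷ _ ∷ _ ∷ _ ∷ []} _ _ _ = ≤-refl
  below {xs = a ∷ _ ∷ _ ∷ _ ∷ _ ∷ _}
        ((a<b ∷ a<c ∷ _) ∷ (b<c ∷ b<d ∷ _) ∷ (c<d ∷ _) ∷ (d<e ∷ _) ∷ _)
        (_ ∷ _ ∷ _ ∷ _ ∷ e<33 ∷ _) cl
    with x , refl ← gap a<b with y , refl ← gap b<c with z , refl ← gap c<d with w , refl ← gap d<e =
    ⊥-elim (no-mono-5-set a x y z w e<33
      (cl a∈ b∈ c∈ d∈ a<b b<c c<d) (cl b∈ c∈ d∈ e∈ b<c c<d d<e) (cl a∈ c∈ d∈ e∈ a<c c<d d<e)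
      (cl a∈ b∈ d∈ e∈ a<b b<d d<e) (cl a∈ b∈ c∈ e∈ a<b b<c (<-trans c<d d<e)))
    where
    a∈ = here refl
    b∈ = there (here refl)
    c∈ = there (there (here refl))
    d∈ = there (there (there (here refl)))
    e∈ = there (there (there (there (here refl))))

-- The chain of products

-- Some colouring of the 4-sets of N points avoids (p , q).
Avoidable : ℕ → ℕ → ℕ → Set
Avoidable N p q = ∃[ f ] Avoids f N p q

exchange-colours : ∀ {N p q} → Avoidable N p q → Avoidable N q p
exchange-colours (f , av) = exchange f , exchange-avoids av

product-avoidable : ∀ {N d p q s} .{{_ : NonZero N}} → Avoidable N p q → Avoidable d (suc p) (suc s) →
                    2 * s < q → Avoidable (d * N) (suc p) q
product-avoidable {N} (A , avA) (D , avD) 2s<q = product A D N , product-avoids A D N avA avD 2s<q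

-- Two blocks: a clique meets at most s = 2 of them.
double : ∀ {N p q} .{{_ : NonZero N}} → Avoidable N p q → 1 < p → 4 < q → Avoidable (2 * N) (suc p) q
double avA 1<p = product-avoidable avA (allRed , allRed-avoids₂ (s≤s 1<p))

-- When all quadruples across d blocks are red, a blue clique meets at most three
-- blocks, so s = 3.
multiply : ∀ {N p q} d .{{_ : NonZero N}} → Avoidable N p q → d ≤ p → 6 < q → Avoidable (d * N) (suc p) q
multiply d avA d≤p = product-avoidable avA (allRed , allRed-avoids (s≤s d≤p))

avoidable-bound : ∀ {N p q} → Avoidable N p q → r 4 p q ≥ suc N
avoidable-bound (_ , av) = ramsey-lower-bound av

avoidable-33-5-5 : Avoidable 33 5 5
avoidable-33-5-5 = seed , seed-avoids

avoidable-66-5-6 : Avoidable 66 5 6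
avoidable-66-5-6 = exchange-colours (double avoidable-33-5-5 (≤ᵇ⇒≤ _ _ _) (≤ᵇ⇒≤ _ _ _))

avoidable-132-6-6 : Avoidable 132 6 6
avoidable-132-6-6 = double avoidable-66-5-6 (≤ᵇ⇒≤ _ _ _) (≤ᵇ⇒≤ _ _ _)

avoidable-132-5-7 : Avoidable 132 5 7
avoidable-132-5-7 =
  exchange-colours (double (exchange-colours avoidable-66-5-6) (≤ᵇ⇒≤ _ _ _) (≤ᵇ⇒≤ _ _ _))

avoidable-660-6-7 : Avoidable 660 6 7
avoidable-660-6-7 = multiply 5 avoidable-132-5-7 (≤ᵇ⇒≤ _ _ _) (≤ᵇ⇒≤ _ _ _)

avoidable-3960-7-7 : Avoidable 3960 7 7
avoidable-3960-7-7 = multiply 6 avoidable-660-6-7 (≤ᵇ⇒≤ _ _ _) (≤ᵇ⇒≤ _ _ _)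

avoidable-27720-7-8 : Avoidable 27720 7 8
avoidable-27720-7-8 = exchange-colours (multiply 7 avoidable-3960-7-7 (≤ᵇ⇒≤ _ _ _) (≤ᵇ⇒≤ _ _ _))

avoidable-194040-8-8 : Avoidable 194040 8 8
avoidable-194040-8-8 = multiply 7 avoidable-27720-7-8 (≤ᵇ⇒≤ _ _ _) (≤ᵇ⇒≤ _ _ _)

-- Blue cliques of the colouring on 660 points have at most s = 6 points, and
-- 2 * 6 < 13.
avoidable-87120-6-13 : Avoidable 87120 6 13
avoidable-87120-6-13 =
  product-avoidable (A , weaken-blue (≤ᵇ⇒≤ _ _ _) avA) avoidable-660-6-7 (≤ᵇ⇒≤ _ _ _)
  where
  A   = proj₁ avoidable-132-5-7
  avA = proj₂ avoidable-132-5-7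

mainTheorem7 : r 4 5 6 ≥ 67 ×
    r 4 6 6 ≥ 133 ×
    r 4 6 7 ≥ 661 ×
    r 4 6 13 ≥ 50689 ×
    r 4 7 7 ≥ 3961 ×
    r 4 8 8 ≥ 194041
mainTheorem7 =
  avoidable-bound avoidable-66-5-6 ,
  avoidable-bound avoidable-132-6-6 ,
  avoidable-bound avoidable-660-6-7 ,
  ≤-trans (≤ᵇ⇒≤ _ _ _) (avoidable-bound avoidable-87120-6-13) ,
  avoidable-bound avoidable-3960-7-7 ,
  avoidable-bound avoidable-194040-8-8
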